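{- Let $\mathbf{F}_q$ be a finite field of characteristic $p$, and for $D\subseteq\mathbf{F}_q$, $k\ge1$, $b\in\mathbf{F}_q$ let $N(k,b,D)$ be the number of $k$-element subsets of $D$ whose elements sum to $b$. Define $v(b)=-1$ if $b\ne0$ and $v(b)=q-1$ if $b=0$. Then for every $b\in\mathbf{F}_q$: for $1\le k\le q-1$, $$N(k,b,\mathbf{F}_q^*)=\frac1q\binom{q-1}{k}+(-1)^{k+\lfloor k/p\rfloor}\frac{v(b)}{q}\binom{q/p-1}{\lfloor k/p\rfloor};$$ for $1\le k\le q$ with $p\nmid k$, $$N(k,b,\mathbf{F}_q)=\frac1q\binom{q}{k};$$ for $1\le k\le q$ with $p\mid k$, $$N(k,b,\mathbf{F}_q)=\frac1q\binom{q}{k}+(-1)^{k+k/p}\frac{v(b)}{q}\binom{q/p}{k/p}.$$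
   Context: $\mathbf{F}_q^*=\mathbf{F}_q\setminus\{0\}$. $\lfloor a\rfloor$ is the largest integer not exceeding $a$. The binomial coefficient is $\binom{x}{k}=x(x-1)\cdots(x-k+1)/k!$ for real $x$ and integer $k\ge0$ (so $\binom{0}{0}=1$ and $\binom{0}{k}=0$ for $k>0$). -}

module Defs where

open import Level using (Level; _⊔_) renaming (suc to lsuc)
open import Algebra.Bundles using (CommutativeRing)
open import Data.Bool using (Bool; true; false; _∧_; not)
open import Data.Nat using (ℕ; zero; suc; NonZero; _<_; _≡ᵇ_; _∸_) renaming (_/_ to _/ℕ_)
open import Data.Nat.Combinatorics using (_C_)
open import Data.Integer using (ℤ; +_; -1ℤ; _^_) renaming (_*_ to _*ℤ_; -_ to -ℤ_)
open import Data.Rational using (ℚ; _/_) renaming (_+_ to _+ℚ_)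
open import Data.Fin using (Fin)
import Data.Fin as Fin
open import Data.Fin.Subset using (Subset; inside; outside; ∣_∣; ⊤)
open import Data.Fin.Subset.Properties using (_⊆?_)
open import Data.Vec using (Vec; []; _∷_; tabulate)
open import Data.List using (List; []; _∷_; _++_; map; filterᵇ; length)
open import Data.Product using (∃; _,_)
open import Relation.Nullary using (¬_; does)
open import Relation.Binary using (Decidable)
open import Relation.Binary.PropositionalEquality using (_≡_)

record FiniteField (c ℓ : Level) : Set (lsuc (c ⊔ ℓ)) where
  field
    commRing : CommutativeRing c ℓ
  open CommutativeRing commRing public
  field
    1≉0       : ¬ (1# ≈ 0#)
    inverse   : ∀ x → ¬ (x ≈ 0#) → ∃ λ y → (x * y) ≈ 1#
    _≟_       : Decidable _≈_
    q         : ℕ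
    enum      : Fin q → Carrier
    enum-inj  : ∀ i j → enum i ≈ enum j → i ≡ j
    enum-surj : ∀ x → ∃ λ i → enum i ≈ x

module _ {c ℓ : Level} (F : FiniteField c ℓ) where
  open FiniteField F

  natF : ℕ → Carrier
  natF zero    = 0#
  natF (suc n) = 1# + natF n

  record HasCharacteristic (p : ℕ) : Set ℓ where
    field
      {{p-nonZero}} : NonZero p
      p·1≈0         : natF p ≈ 0#
      minimal       : ∀ m → 0 < m → m < p → ¬ (natF m ≈ 0#)

  q-nonZero : NonZero q
  q-nonZero with enum-surj 0#
  ... | (Fin.zero , _) = _
  ... | (Fin.suc _ , _) = _

  sumOver : ∀ {n} → (Fin n → Carrier) → Subset n → Carrier
  sumOver f []              = 0#
  sumOver f (inside  ∷ s)   = f Fin.zero + sumOver (λ i → f (Fin.suc i)) s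
  sumOver f (outside ∷ s)   = sumOver (λ i → f (Fin.suc i)) s

  subsetSum : Subset q → Carrier
  subsetSum = sumOver enum

  Fq : Subset q
  Fq = ⊤

  Fq* : Subset q
  Fq* = tabulate (λ i → not (does (enum i ≟ 0#)))

  N : ℕ → Carrier → Subset q → ℕ
  N k b D = length (filterᵇ (λ S → does (S ⊆? D) ∧ (∣ S ∣ ≡ᵇ k) ∧ does (subsetSum S ≟ b)) (allSubsets q))
    where
    allSubsets : ∀ n → List (Subset n)
    allSubsets zero    = [] ∷ []
    allSubsets (suc n) = map (inside ∷_) (allSubsets n) ++ map (outside ∷_) (allSubsets n)

  v : Carrier → ℤ
  v b with does (b ≟ 0#)
  ... | true  = + (q ∸ 1)
  ... | false = -1ℤ

{-# OPTIONS --safe #-}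

-- For a family of field elements, let c k b be the number of its k-element subfamilies with sum b,
-- and M m k b the number of pairs (x, T) with T a (k-1)-element subfamily avoiding the position x
-- and m x + ΣT = b.  Deciding whether x lies in the subfamily gives
--   Σₓ c k (b - m x) = M m (k+1) b + M (m+1) k b,
-- which is Newton's identity for power sums without group-ring or character arithmetic.  For the
-- family of all elements of the field the left-hand side does not depend on b when m ≠ 0, so the
-- discrepancies c k 0 - c k b and M m k 0 - M m k b can be carried from m = 1 up to m = p = 0.
-- There M 1 k = k c k and M 0 (k+1) = (q - k) c k, whence for d k = c k 0 - c k b and b ≠ 0
--   (k + p) d (k+p) = (-1)^(p+1) (q - k) d k,   d 0 = 1,   d k = 0 for 0 < k < p.
-- This determines d, and d together with Σ_b c k b = C(q, k) determines c.  The count for the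
-- nonzero elements follows by deciding whether 0 is chosen, and Pascal's rule.
module Submission where

open import Defs
open import Data.Nat using (ℕ; _≤_) renaming (_+_ to _+ℕ_; _∸_ to _∸ℕ_; _/_ to _/ℕ_)
open import Data.Nat.Combinatorics using (_C_)
open import Data.Nat.Divisibility using (_∣_; _∤_)
open import Data.Integer using (+_; -1ℤ; _^_) renaming (_*_ to _*ℤ_)
open import Data.Rational using (ℚ; _/_) renaming (_+_ to _+ℚ_)
open import Data.Product using (_×_)
open import Relation.Binary.PropositionalEquality using (_≡_)

open import Data.Nat using (zero; suc; NonZero; _<_; _≡ᵇ_; z<s; >-nonZero; >-nonZero⁻¹) renaming (_*_ to _*ℕ_; _%_ to _%ℕ_)
import Data.Nat.Properties as ℕₚ
import Data.Nat.Tactic.RingSolver as ℕ-Solver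
open import Data.Nat.Combinatorics using (nCn≡1; nC1≡n; nCk+nC[k+1]≡[n+1]C[k+1])
open import Data.Nat.Divisibility using (_∣?_; divides; m%n≡0⇒n∣m; n∣m*n; ∣⇒≤)
open import Data.Nat.DivMod using (m≡m%n+[m/n]*n; m%n<n; m*n/n≡m; m<n⇒m/n≡0; m≥n⇒m/n>0; +-distrib-/-∣ʳ; m/n*n≡m)
open import Data.Integer using (ℤ; 0ℤ; 1ℤ; ∣_∣) renaming (_+_ to _+ℤ_; _-_ to _-ℤ_)
import Data.Integer.Properties as ℤₚ
import Data.Integer.Tactic.RingSolver as ℤ-Solver
open import Data.Rational using (toℚᵘ)
import Data.Rational.Properties as ℚₚ
open import Data.Rational.Unnormalised as ℚᵘ using (mkℚᵘ; *≡*)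
import Data.Rational.Unnormalised.Properties as ℚᵘₚ
open import Data.Bool using (Bool; true; false; if_then_else_; not; _∧_)
open import Data.Bool.Properties using (∧-zeroʳ)
open import Data.Fin using (Fin; zero; suc; punchIn)
import Data.Fin.Properties as Finₚ
open import Data.Fin.Permutation using (permutation)
open import Data.Fin.Subset as Subset using (Subset; inside; outside; ⊤)
open import Data.Fin.Subset.Properties using (_⊆?_)
open import Data.List using (List; []; _∷_; _++_; map; filterᵇ; length; tabulate)
open import Data.List.Properties using (length-tabulate; length-++; filter-++)
import Data.Vec as Vec
open import Data.Product using (_,_; proj₁; proj₂)
open import Function using (_∘_; mk⇔)
open import Relation.Nullary using (¬_; does; yes; no; contradiction)
open import Relation.Nullary.Decidable using (does-⇔; dec-true; dec-false; decidable-stable)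
open import Relation.Binary.PropositionalEquality using (_≢_; refl; sym; trans; cong; cong₂; subst; module ≡-Reasoning)
open import Algebra.Properties.CommutativeMonoid.Sum ℤₚ.+-0-commutativeMonoid using (sum; sum-permute; sum-remove; sum-cong-≗; sum-replicate-zero; ∑-distrib-+)
import Algebra.Properties.Ring as RingProperties
import Relation.Binary.Reasoning.Setoid as SetoidReasoning

-- Binomial absorption and quotients by p.

-- The relation (k+1) C(n,k+1) = (n-k) C(n,k) with k C(n,k) moved to the left, so that no truncated
-- subtraction occurs. It follows from Pascal's rule by induction on n.
[1+k]*nC[1+k]+k*nCk≡n*nCk : ∀ n k → suc k *ℕ (n C suc k) +ℕ k *ℕ (n C k) ≡ n *ℕ (n C k)
[1+k]*nC[1+k]+k*nCk≡n*nCk zero    zero    = refl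
[1+k]*nC[1+k]+k*nCk≡n*nCk zero    (suc k) = cong₂ _+ℕ_ (ℕₚ.*-zeroʳ k) (ℕₚ.*-zeroʳ k)
[1+k]*nC[1+k]+k*nCk≡n*nCk (suc n) zero    rewrite nC1≡n (suc n) = arith n
  where
  arith : ∀ n → (suc n +ℕ 0) +ℕ 0 ≡ suc n *ℕ 1
  arith = ℕ-Solver.solve-∀
[1+k]*nC[1+k]+k*nCk≡n*nCk (suc n) (suc k)
  rewrite sym (nCk+nC[k+1]≡[n+1]C[k+1] n (suc k)) | sym (nCk+nC[k+1]≡[n+1]C[k+1] n k) = begin
    suc (suc k) *ℕ (y +ℕ z) +ℕ suc k *ℕ (x +ℕ y)
      ≡⟨ arith k x y z ⟩
    ((suc (suc k) *ℕ z +ℕ suc k *ℕ y) +ℕ (suc k *ℕ y +ℕ k *ℕ x)) +ℕ (x +ℕ y)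
      ≡⟨ cong₂ (λ u v → (u +ℕ v) +ℕ (x +ℕ y)) ([1+k]*nC[1+k]+k*nCk≡n*nCk n (suc k)) ([1+k]*nC[1+k]+k*nCk≡n*nCk n k) ⟩
    (n *ℕ y +ℕ n *ℕ x) +ℕ (x +ℕ y)
      ≡⟨ arith′ n x y ⟩
    suc n *ℕ (x +ℕ y) ∎
  where
  open ≡-Reasoning
  x = n C k
  y = n C suc k
  z = n C suc (suc k)
  arith : ∀ k x y z → suc (suc k) *ℕ (y +ℕ z) +ℕ suc k *ℕ (x +ℕ y)
        ≡ ((suc (suc k) *ℕ z +ℕ suc k *ℕ y) +ℕ (suc k *ℕ y +ℕ k *ℕ x)) +ℕ (x +ℕ y)
  arith = ℕ-Solver.solve-∀
  arith′ : ∀ n x y → (n *ℕ y +ℕ n *ℕ x) +ℕ (x +ℕ y) ≡ suc n *ℕ (x +ℕ y)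
  arith′ = ℕ-Solver.solve-∀

[j+m*p]/p≡m : ∀ {p} .{{_ : NonZero p}} j m → j < p → (j +ℕ m *ℕ p) /ℕ p ≡ m
[j+m*p]/p≡m {p} j m j<p = begin
  (j +ℕ m *ℕ p) /ℕ p        ≡⟨ +-distrib-/-∣ʳ j (n∣m*n m) ⟩
  j /ℕ p +ℕ m *ℕ p /ℕ p     ≡⟨ cong₂ _+ℕ_ (m<n⇒m/n≡0 j<p) (m*n/n≡m m p) ⟩
  m                         ∎
  where open ≡-Reasoning

-- A first-order recurrence with step p and its solution.

module Recurrence
  (f : ℕ → ℤ) (s : ℤ) (p q : ℕ) {{_ : NonZero p}}
  (f0≡1 : f 0 ≡ 1ℤ)
  (initial : ∀ k → 0 < k → k < p → f k ≡ 0ℤ)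
  (step : ∀ k → + (k +ℕ p) *ℤ f (k +ℕ p) ≡ s *ℤ ((+ q -ℤ + k) *ℤ f k))
  where

  private
    instance
      k+p≢0 : ∀ {k} → NonZero (k +ℕ p)
      k+p≢0 {k} = >-nonZero (ℕₚ.<-≤-trans (>-nonZero⁻¹ p) (ℕₚ.m≤n+m p k))

  -- The recurrence stays within one residue class modulo p. In a nonzero class it starts from 0 and
  -- stays there, since the factor k + p is positive and can be cancelled.
  vanishes : ∀ m j → 0 < j → j < p → f (j +ℕ m *ℕ p) ≡ 0ℤ
  vanishes zero    j 0<j j<p rewrite ℕₚ.+-identityʳ j = initial j 0<j j<p
  vanishes (suc m) j 0<j j<p = begin
    f (j +ℕ (p +ℕ m *ℕ p))   ≡⟨ cong f (arith j p (m *ℕ p)) ⟩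
    f (k +ℕ p)               ≡⟨ ℤₚ.*-cancelˡ-≡ (+ (k +ℕ p)) _ _ cancelled ⟩
    0ℤ                       ∎
    where
    open ≡-Reasoning
    k = j +ℕ m *ℕ p
    arith : ∀ a b c → a +ℕ (b +ℕ c) ≡ (a +ℕ c) +ℕ b
    arith = ℕ-Solver.solve-∀
    arith′ : ∀ a b c → a *ℤ (b *ℤ 0ℤ) ≡ c *ℤ 0ℤ
    arith′ = ℤ-Solver.solve-∀
    cancelled : + (k +ℕ p) *ℤ f (k +ℕ p) ≡ + (k +ℕ p) *ℤ 0ℤ
    cancelled = begin
      + (k +ℕ p) *ℤ f (k +ℕ p)      ≡⟨ step k ⟩
      s *ℤ ((+ q -ℤ + k) *ℤ f k)    ≡⟨ cong (λ x → s *ℤ ((+ q -ℤ + k) *ℤ x)) (vanishes m j 0<j j<p) ⟩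
      s *ℤ ((+ q -ℤ + k) *ℤ 0ℤ)     ≡⟨ arith′ s (+ q -ℤ + k) (+ (k +ℕ p)) ⟩
      + (k +ℕ p) *ℤ 0ℤ              ∎

  vanishes-∤ : ∀ k → p ∤ k → f k ≡ 0ℤ
  vanishes-∤ k p∤k = trans (cong f (m≡m%n+[m/n]*n k p))
    (vanishes (k /ℕ p) (k %ℕ p) (ℕₚ.n≢0⇒n>0 (λ k%p≡0 → p∤k (m%n≡0⇒n∣m k p k%p≡0))) (m%n<n k p))

  -- With q = r p and k = m p the recurrence is p times (m+1) f((m+1)p) = s (r-m) f(mp). Up to the
  -- powers of s this is absorption for C(r,m), with the same value 1 at m = 0.
  at-multiples : ∀ r → q ≡ r *ℕ p → ∀ m → f (m *ℕ p) ≡ s ^ m *ℤ + (r C m)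
  at-multiples r q≡r*p zero    = f0≡1
  at-multiples r q≡r*p (suc m) = begin
    f (p +ℕ m *ℕ p)               ≡⟨ cong f (ℕₚ.+-comm p k) ⟩
    f (k +ℕ p)                    ≡⟨ ℤₚ.*-cancelˡ-≡ (+ (k +ℕ p)) _ _ cancelled ⟩
    s ^ suc m *ℤ + (r C suc m)    ∎
    where
    open ≡-Reasoning
    k = m *ℕ p
    +q : + q ≡ + r *ℤ + p
    +q = trans (cong +_ q≡r*p) (ℤₚ.pos-* r p)
    +[k+p] : + (k +ℕ p) ≡ (1ℤ +ℤ + m) *ℤ + p
    +[k+p] = trans (cong +_ (ℕₚ.+-comm k p)) (ℤₚ.pos-* (suc m) p)
    absorption : (1ℤ +ℤ + m) *ℤ + (r C suc m) +ℤ + m *ℤ + (r C m) ≡ + r *ℤ + (r C m)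
    absorption = begin
      + suc m *ℤ + (r C suc m) +ℤ + m *ℤ + (r C m)   ≡⟨ cong₂ _+ℤ_ (ℤₚ.pos-* (suc m) (r C suc m)) (ℤₚ.pos-* m (r C m)) ⟨
      + (suc m *ℕ (r C suc m) +ℕ m *ℕ (r C m))       ≡⟨ cong +_ ([1+k]*nC[1+k]+k*nCk≡n*nCk r m) ⟩
      + (r *ℕ (r C m))                               ≡⟨ ℤₚ.pos-* r (r C m) ⟩
      + r *ℤ + (r C m)                               ∎
    arith : ∀ s t r m p c → s *ℤ ((r *ℤ p -ℤ m *ℤ p) *ℤ (t *ℤ c)) ≡ (s *ℤ t) *ℤ (p *ℤ (r *ℤ c -ℤ m *ℤ c))
    arith = ℤ-Solver.solve-∀
    arith′ : ∀ t m p x c → t *ℤ (p *ℤ (((1ℤ +ℤ m) *ℤ x +ℤ m *ℤ c) -ℤ m *ℤ c)) ≡ ((1ℤ +ℤ m) *ℤ p) *ℤ (t *ℤ x)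
    arith′ = ℤ-Solver.solve-∀
    cancelled : + (k +ℕ p) *ℤ f (k +ℕ p) ≡ + (k +ℕ p) *ℤ (s ^ suc m *ℤ + (r C suc m))
    cancelled = begin
      + (k +ℕ p) *ℤ f (k +ℕ p)
        ≡⟨ step k ⟩
      s *ℤ ((+ q -ℤ + k) *ℤ f k)
        ≡⟨ cong₂ (λ x y → s *ℤ (x *ℤ y)) (cong₂ _-ℤ_ +q (ℤₚ.pos-* m p)) (at-multiples r q≡r*p m) ⟩
      s *ℤ ((+ r *ℤ + p -ℤ + m *ℤ + p) *ℤ (s ^ m *ℤ + (r C m)))
        ≡⟨ arith s (s ^ m) (+ r) (+ m) (+ p) (+ (r C m)) ⟩
      s ^ suc m *ℤ (+ p *ℤ (+ r *ℤ + (r C m) -ℤ + m *ℤ + (r C m)))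
        ≡⟨ cong (λ x → s ^ suc m *ℤ (+ p *ℤ (x -ℤ + m *ℤ + (r C m)))) absorption ⟨
      s ^ suc m *ℤ (+ p *ℤ (((1ℤ +ℤ + m) *ℤ + (r C suc m) +ℤ + m *ℤ + (r C m)) -ℤ + m *ℤ + (r C m)))
        ≡⟨ arith′ (s ^ suc m) (+ m) (+ p) (+ (r C suc m)) (+ (r C m)) ⟩
      ((1ℤ +ℤ + m) *ℤ + p) *ℤ (s ^ suc m *ℤ + (r C suc m))
        ≡⟨ cong (_*ℤ (s ^ suc m *ℤ + (r C suc m))) +[k+p] ⟨
      + (k +ℕ p) *ℤ (s ^ suc m *ℤ + (r C suc m)) ∎

-- The signed binomial coefficient and its Pascal rule.

-- The factor of v(b)/q in the formulas: n is q/p for the whole field and q/p - 1 for the nonzero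
-- elements.
signedBinomial : ℕ → (p : ℕ) .{{_ : NonZero p}} → ℕ → ℤ
signedBinomial n p k = -1ℤ ^ (k +ℕ k /ℕ p) *ℤ + (n C (k /ℕ p))

-- At k = mp the exponent k + k/p is (p+1)m, so the sign is the m-th power of the constant
-- (-1)^(p+1) of the recurrence.
signedBinomial-multiple : ∀ n p .{{_ : NonZero p}} m → signedBinomial n p (m *ℕ p) ≡ (-1ℤ ^ suc p) ^ m *ℤ + (n C m)
signedBinomial-multiple n p m = begin
  -1ℤ ^ (m *ℕ p +ℕ m *ℕ p /ℕ p) *ℤ + (n C (m *ℕ p /ℕ p))  ≡⟨ cong (λ h → -1ℤ ^ (m *ℕ p +ℕ h) *ℤ + (n C h)) (m*n/n≡m m p) ⟩
  -1ℤ ^ (m *ℕ p +ℕ m) *ℤ + (n C m)                         ≡⟨ cong (λ e → -1ℤ ^ e *ℤ + (n C m)) (arith m p) ⟩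
  -1ℤ ^ (suc p *ℕ m) *ℤ + (n C m)                          ≡⟨ cong (_*ℤ + (n C m)) (ℤₚ.^-*-assoc -1ℤ (suc p) m) ⟨
  (-1ℤ ^ suc p) ^ m *ℤ + (n C m)                           ∎
  where
  open ≡-Reasoning
  arith : ∀ m p → m *ℕ p +ℕ m ≡ suc p *ℕ m
  arith = ℕ-Solver.solve-∀

-- Passing from k to k+1 leaves the floor unchanged, so only the sign flips and the two terms
-- cancel.
signedBinomial-pascal-∤ : ∀ n p .{{_ : NonZero p}} k → p ∤ suc k →
  signedBinomial n p (suc k) +ℤ signedBinomial n p k ≡ 0ℤ
signedBinomial-pascal-∤ n p k p∤1+k = begin
  signedBinomial n p (suc k) +ℤ signedBinomial n p k
    ≡⟨ cong (λ h → -1ℤ ^ (suc k +ℕ h) *ℤ + (n C h) +ℤ signedBinomial n p k) [1+k]/p≡k/p ⟩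
  (-1ℤ *ℤ x) *ℤ y +ℤ x *ℤ y
    ≡⟨ arith x y ⟩
  0ℤ ∎
  where
  open ≡-Reasoning
  x = -1ℤ ^ (k +ℕ k /ℕ p)
  y = + (n C (k /ℕ p))
  arith : ∀ x y → (-1ℤ *ℤ x) *ℤ y +ℤ x *ℤ y ≡ 0ℤ
  arith = ℤ-Solver.solve-∀
  1+k%p≢p : suc (k %ℕ p) ≢ p
  1+k%p≢p eq = p∤1+k (divides (suc (k /ℕ p)) (trans (cong suc (m≡m%n+[m/n]*n k p)) (cong (_+ℕ k /ℕ p *ℕ p) eq)))
  [1+k]/p≡k/p : suc k /ℕ p ≡ k /ℕ p
  [1+k]/p≡k/p = trans (cong (λ h → suc h /ℕ p) (m≡m%n+[m/n]*n k p))
    ([j+m*p]/p≡m (suc (k %ℕ p)) (k /ℕ p) (ℕₚ.≤∧≢⇒< (m%n<n k p) 1+k%p≢p))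

-- Passing from k to k+1 raises the floor by one and hence the exponent by two. The signs agree and
-- Pascal's rule for n applies.
signedBinomial-pascal-∣ : ∀ n p .{{_ : NonZero p}} k → p ∣ suc k →
  signedBinomial n p (suc k) +ℤ signedBinomial n p k ≡ signedBinomial (suc n) p (suc k)
signedBinomial-pascal-∣ n p@(suc p-1) k (divides (suc m) 1+k≡p+m*p) = begin
  signedBinomial n p (suc k) +ℤ signedBinomial n p k
    ≡⟨ cong₂ (λ g h → -1ℤ ^ (suc k +ℕ g) *ℤ + (n C g) +ℤ -1ℤ ^ (k +ℕ h) *ℤ + (n C h)) [1+k]/p≡1+m k/p≡m ⟩
  -1ℤ ^ (suc k +ℕ suc m) *ℤ + (n C suc m) +ℤ x *ℤ + (n C m)
    ≡⟨ cong (λ y → y *ℤ + (n C suc m) +ℤ x *ℤ + (n C m)) sign ⟩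
  x *ℤ + (n C suc m) +ℤ x *ℤ + (n C m)
    ≡⟨ arith x (+ (n C suc m)) (+ (n C m)) ⟩
  x *ℤ + (n C m +ℕ n C suc m)
    ≡⟨ cong₂ (λ y z → y *ℤ + z) (sym sign) (nCk+nC[k+1]≡[n+1]C[k+1] n m) ⟩
  -1ℤ ^ (suc k +ℕ suc m) *ℤ + (suc n C suc m)
    ≡⟨ cong (λ g → -1ℤ ^ (suc k +ℕ g) *ℤ + (suc n C g)) [1+k]/p≡1+m ⟨
  signedBinomial (suc n) p (suc k) ∎
  where
  open ≡-Reasoning
  x = -1ℤ ^ (k +ℕ m)
  arith : ∀ x y z → x *ℤ y +ℤ x *ℤ z ≡ x *ℤ (z +ℤ y)
  arith = ℤ-Solver.solve-∀
  double-neg : ∀ x → -1ℤ *ℤ (-1ℤ *ℤ x) ≡ x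
  double-neg = ℤ-Solver.solve-∀
  sign : -1ℤ ^ (suc k +ℕ suc m) ≡ x
  sign = trans (cong (λ e → -1ℤ ^ suc e) (ℕₚ.+-suc k m)) (double-neg x)
  [1+k]/p≡1+m : suc k /ℕ p ≡ suc m
  [1+k]/p≡1+m = trans (cong (_/ℕ p) 1+k≡p+m*p) (m*n/n≡m (suc m) p)
  k/p≡m : k /ℕ p ≡ m
  k/p≡m = trans (cong (_/ℕ p) (ℕₚ.suc-injective 1+k≡p+m*p)) ([j+m*p]/p≡m p-1 m (ℕₚ.n<1+n p-1))

-- Division by q, signs and finite sums.

-- The counting is done in ℤ, multiplied through by q; this turns its results into the fractions of
-- the theorem.
n*a≡i⇒a≡i/n : ∀ n .{{_ : NonZero n}} a i → + n *ℤ a ≡ i → a / 1 ≡ i / n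
n*a≡i⇒a≡i/n (suc n) a i eq = ℚₚ.fromℚᵘ-cong {mkℚᵘ a 0} {mkℚᵘ i n} (*≡* (begin
  a *ℤ + suc n    ≡⟨ ℤₚ.*-comm a (+ suc n) ⟩
  + suc n *ℤ a    ≡⟨ eq ⟩
  i               ≡⟨ ℤₚ.*-identityʳ i ⟨
  i *ℤ + 1        ∎))
  where open ≡-Reasoning

+-distribʳ-/ : ∀ n .{{_ : NonZero n}} i j → (i +ℤ j) / n ≡ i / n +ℚ j / n
+-distribʳ-/ (suc n) i j = ℚₚ.toℚᵘ-injective (begin-equality
  toℚᵘ ((i +ℤ j) / suc n)                   ≃⟨ ℚₚ.toℚᵘ-fromℚᵘ (mkℚᵘ (i +ℤ j) n) ⟩
  mkℚᵘ (i +ℤ j) n                           ≃⟨ *≡* (arith i j (+ suc n)) ⟩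
  mkℚᵘ i n ℚᵘ.+ mkℚᵘ j n                    ≃⟨ ℚᵘₚ.+-cong (ℚₚ.toℚᵘ-fromℚᵘ (mkℚᵘ i n)) (ℚₚ.toℚᵘ-fromℚᵘ (mkℚᵘ j n)) ⟨
  toℚᵘ (i / suc n) ℚᵘ.+ toℚᵘ (j / suc n)    ≃⟨ ℚₚ.toℚᵘ-homo-+ (i / suc n) (j / suc n) ⟨
  toℚᵘ (i / suc n +ℚ j / suc n)             ∎)
  where
  open ℚᵘₚ.≤-Reasoning
  arith : ∀ i j n → (i +ℤ j) *ℤ (n *ℤ n) ≡ (i *ℤ n +ℤ j *ℤ n) *ℤ n
  arith = ℤ-Solver.solve-∀

-1^n*-1^n*i≡i : ∀ n i → -1ℤ ^ n *ℤ (-1ℤ ^ n *ℤ i) ≡ i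
-1^n*-1^n*i≡i zero    i = arith i
  where
  arith : ∀ i → 1ℤ *ℤ (1ℤ *ℤ i) ≡ i
  arith = ℤ-Solver.solve-∀
-1^n*-1^n*i≡i (suc n) i = trans (arith (-1ℤ ^ n) i) (-1^n*-1^n*i≡i n i)
  where
  arith : ∀ x i → (-1ℤ *ℤ x) *ℤ ((-1ℤ *ℤ x) *ℤ i) ≡ x *ℤ (x *ℤ i)
  arith = ℤ-Solver.solve-∀

sum-supported-at : ∀ {n} (t : Fin n → ℤ) i → (∀ j → j ≢ i → t j ≡ 0ℤ) → sum t ≡ t i
sum-supported-at {suc n} t i t≡0 = begin
  sum t                                  ≡⟨ sum-remove {i = i} t ⟩
  t i +ℤ sum (λ j → t (punchIn i j))     ≡⟨ cong (t i +ℤ_) (sum-cong-≗ (λ j → t≡0 (punchIn i j) (Finₚ.punchInᵢ≢i i j))) ⟩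
  t i +ℤ sum {n} (λ _ → 0ℤ)              ≡⟨ cong (t i +ℤ_) (sum-replicate-zero n) ⟩
  t i +ℤ 0ℤ                              ≡⟨ ℤₚ.+-identityʳ (t i) ⟩
  t i                                    ∎
  where open ≡-Reasoning

Fin1-unique : ∀ {n} → n ≡ 1 → (i j : Fin n) → i ≡ j
Fin1-unique refl zero zero = refl

-- Enumeration of subsets and counting by a predicate.

-- Repeats the equations of the enumeration inside `N`, so that the two lists can be identified by
-- induction on n.
subsets : ∀ n → List (Subset n)
subsets zero    = Vec.[] ∷ []
subsets (suc n) = map (inside Vec.∷_) (subsets n) ++ map (outside Vec.∷_) (subsets n)

numberOf : ∀ {n} → (Subset n → Bool) → ℕ
numberOf {n} P = length (filterᵇ P (subsets n))

length-filterᵇ-cong : ∀ {A : Set} {P Q : A → Bool} → (∀ x → P x ≡ Q x) → ∀ xs → length (filterᵇ P xs) ≡ length (filterᵇ Q xs)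
length-filterᵇ-cong P≗Q [] = refl
length-filterᵇ-cong {Q = Q} P≗Q (x ∷ xs) rewrite P≗Q x with Q x
... | true  = cong suc (length-filterᵇ-cong P≗Q xs)
... | false = length-filterᵇ-cong P≗Q xs

length-filterᵇ-map : ∀ {A B : Set} (P : B → Bool) (f : A → B) xs → length (filterᵇ P (map f xs)) ≡ length (filterᵇ (P ∘ f) xs)
length-filterᵇ-map P f [] = refl
length-filterᵇ-map P f (x ∷ xs) with P (f x)
... | true  = cong suc (length-filterᵇ-map P f xs)
... | false = length-filterᵇ-map P f xs

length-filterᵇ-false : ∀ {A : Set} (xs : List A) → length (filterᵇ (λ _ → false) xs) ≡ 0
length-filterᵇ-false []       = refl
length-filterᵇ-false (x ∷ xs) = length-filterᵇ-false xs

numberOf-suc : ∀ {n} (P : Subset (suc n) → Bool) →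
  numberOf P ≡ numberOf (λ S → P (inside Vec.∷ S)) +ℕ numberOf (λ S → P (outside Vec.∷ S))
numberOf-suc {n} P = begin
  length (filterᵇ P (map (inside Vec.∷_) (subsets n) ++ map (outside Vec.∷_) (subsets n)))
    ≡⟨ cong length (filter-++ _ (map (inside Vec.∷_) (subsets n)) _) ⟩
  length (filterᵇ P (map (inside Vec.∷_) (subsets n)) ++ filterᵇ P (map (outside Vec.∷_) (subsets n)))
    ≡⟨ length-++ (filterᵇ P (map (inside Vec.∷_) (subsets n))) ⟩
  length (filterᵇ P (map (inside Vec.∷_) (subsets n))) +ℕ length (filterᵇ P (map (outside Vec.∷_) (subsets n)))
    ≡⟨ cong₂ _+ℕ_ (length-filterᵇ-map P _ (subsets n)) (length-filterᵇ-map P _ (subsets n)) ⟩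
  numberOf (λ S → P (inside Vec.∷ S)) +ℕ numberOf (λ S → P (outside Vec.∷ S)) ∎
  where open ≡-Reasoning

module _ {c ℓ} (F : FiniteField c ℓ) where
  private
    module K = FiniteField F
    module ≈-Reasoning = SetoidReasoning K.setoid
  open K using (Carrier; _≈_; _+_; _*_; _-_; -_; 0#; 1#; _≟_; q; enum)
  open RingProperties K.ring using (-‿+-comm; -0#≈0#; -‿involutive)
  open ≡-Reasoning

  -- Subfamilies counted by their sum, and Newton's identity.

  δ : Carrier → ℤ
  δ b = if does (b ≟ 0#) then 1ℤ else 0ℤ

  δ-cong : ∀ {a b} → a ≈ b → δ a ≡ δ b
  δ-cong {a} {b} a≈b = cong (if_then 1ℤ else 0ℤ)
    (does-⇔ (mk⇔ (K.trans (K.sym a≈b)) (K.trans a≈b)) (a ≟ 0#) (b ≟ 0#))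

  δ-zero : ∀ {b} → b ≈ 0# → δ b ≡ 1ℤ
  δ-zero {b} b≈0 = cong (if_then 1ℤ else 0ℤ) (dec-true (b ≟ 0#) b≈0)

  δ-nonzero : ∀ {b} → ¬ b ≈ 0# → δ b ≡ 0ℤ
  δ-nonzero {b} b≉0 = cong (if_then 1ℤ else 0ℤ) (dec-false (b ≟ 0#) b≉0)

  -- The header's c k b. Subfamilies are sets of positions; a chosen head is subtracted from the
  -- target.
  count : List Carrier → ℕ → Carrier → ℤ
  count []       zero    b = δ b
  count []       (suc k) b = 0ℤ
  count (x ∷ xs) zero    b = count xs zero b
  count (x ∷ xs) (suc k) b = count xs k (b - x) +ℤ count xs (suc k) b

  -- The header's M m k b; k is |T| + 1.
  marked : Carrier → List Carrier → ℕ → Carrier → ℤ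
  marked m xs       zero    b = 0ℤ
  marked m []       (suc k) b = 0ℤ
  marked m (x ∷ xs) (suc k) b = count xs k (b - m * x) +ℤ (marked m xs k (b - x) +ℤ marked m xs (suc k) b)

  Σ[_] : List Carrier → (Carrier → ℤ) → ℤ
  Σ[ [] ]     f = 0ℤ
  Σ[ x ∷ xs ] f = f x +ℤ Σ[ xs ] f

  count-cong : ∀ xs k {a b} → a ≈ b → count xs k a ≡ count xs k b
  count-cong []       zero    a≈b = δ-cong a≈b
  count-cong []       (suc k) a≈b = refl
  count-cong (x ∷ xs) zero    a≈b = count-cong xs zero a≈b
  count-cong (x ∷ xs) (suc k) a≈b = cong₂ _+ℤ_ (count-cong xs k (K.+-congʳ a≈b)) (count-cong xs (suc k) a≈b)

  marked-cong : ∀ {m n} → m ≈ n → ∀ xs k b → marked m xs k b ≡ marked n xs k b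
  marked-cong m≈n xs       zero    b = refl
  marked-cong m≈n []       (suc k) b = refl
  marked-cong m≈n (x ∷ xs) (suc k) b = cong₂ _+ℤ_
    (count-cong xs k (K.+-congˡ (K.-‿cong (K.*-congʳ m≈n))))
    (cong₂ _+ℤ_ (marked-cong m≈n xs k (b - x)) (marked-cong m≈n xs (suc k) b))

  Σ-cong : ∀ xs {f g : Carrier → ℤ} → (∀ x → f x ≡ g x) → Σ[ xs ] f ≡ Σ[ xs ] g
  Σ-cong []       f≗g = refl
  Σ-cong (x ∷ xs) f≗g = cong₂ _+ℤ_ (f≗g x) (Σ-cong xs f≗g)

  Σ-distrib-+ : ∀ xs (f g : Carrier → ℤ) → Σ[ xs ] (λ x → f x +ℤ g x) ≡ Σ[ xs ] f +ℤ Σ[ xs ] g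
  Σ-distrib-+ []       f g = refl
  Σ-distrib-+ (x ∷ xs) f g = trans (cong (f x +ℤ g x +ℤ_) (Σ-distrib-+ xs f g)) (arith (f x) (g x) (Σ[ xs ] f) (Σ[ xs ] g))
    where
    arith : ∀ a b c d → (a +ℤ b) +ℤ (c +ℤ d) ≡ (a +ℤ c) +ℤ (b +ℤ d)
    arith = ℤ-Solver.solve-∀

  Σ-const : ∀ xs i → Σ[ xs ] (λ _ → i) ≡ + length xs *ℤ i
  Σ-const []       i = refl
  Σ-const (x ∷ xs) i = trans (cong (i +ℤ_) (Σ-const xs i)) (arith (+ length xs) i)
    where
    arith : ∀ n i → i +ℤ n *ℤ i ≡ (1ℤ +ℤ n) *ℤ i
    arith = ℤ-Solver.solve-∀

  -‿swap : ∀ b x y → (b - x) - y ≈ (b - y) - x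
  -‿swap b x y = K.trans (K.+-assoc b (- x) (- y)) (K.trans (K.+-congˡ (K.+-comm (- x) (- y))) (K.sym (K.+-assoc b (- y) (- x))))

  -- An x taken with coefficient m that also lies in the subfamily contributes m + 1 copies of
  -- itself; this raises the coefficient in `Σ-count`.
  -‿suc-* : ∀ b m x → (b - m * x) - x ≈ b - (1# + m) * x
  -‿suc-* b m x = R.begin
    (b - m * x) - x        R.≈⟨ -‿swap b (m * x) x ⟩
    (b - x) - m * x        R.≈⟨ K.+-assoc b (- x) (- (m * x)) ⟩
    b + (- x - m * x)      R.≈⟨ K.+-congˡ (-‿+-comm x (m * x)) ⟩
    b - (x + m * x)        R.≈⟨ K.+-congˡ (K.-‿cong (K.+-congʳ (K.*-identityˡ x))) ⟨
    b - (1# * x + m * x)   R.≈⟨ K.+-congˡ (K.-‿cong (K.distribʳ x 1# m)) ⟨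
    b - (1# + m) * x       R.∎
    where module R = ≈-Reasoning

  b-0*x≈b : ∀ b x → b - 0# * x ≈ b
  b-0*x≈b b x = R.begin
    b - 0# * x   R.≈⟨ K.+-congˡ (K.-‿cong (K.zeroˡ x)) ⟩
    b - 0#       R.≈⟨ K.+-congˡ -0#≈0# ⟩
    b + 0#       R.≈⟨ K.+-identityʳ b ⟩
    b            R.∎
    where module R = ≈-Reasoning

  -- Fix a position x. Subfamilies avoiding x give the pairs of the first term; those containing x,
  -- once x is removed from them, give the pairs of the second. The induction makes this decision at
  -- each list entry.
  Σ-count : ∀ m xs k b → Σ[ xs ] (λ x → count xs k (b - m * x)) ≡ marked m xs (suc k) b +ℤ marked (1# + m) xs k b
  Σ-count m []       zero    b = refl
  Σ-count m []       (suc k) b = refl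
  Σ-count m (x ∷ xs) zero    b = begin
    count xs 0 (b - m * x) +ℤ Σ[ xs ] (λ y → count xs 0 (b - m * y))
      ≡⟨ cong (count xs 0 (b - m * x) +ℤ_) (Σ-count m xs 0 b) ⟩
    count xs 0 (b - m * x) +ℤ (marked m xs 1 b +ℤ 0ℤ)
      ≡⟨ arith (count xs 0 (b - m * x)) (marked m xs 1 b) ⟩
    count xs 0 (b - m * x) +ℤ (0ℤ +ℤ marked m xs 1 b) +ℤ 0ℤ ∎
    where
    arith : ∀ i j → i +ℤ (j +ℤ 0ℤ) ≡ i +ℤ (0ℤ +ℤ j) +ℤ 0ℤ
    arith = ℤ-Solver.solve-∀
  Σ-count m (x ∷ xs) (suc k) b = begin
    (count xs k (b - m * x - x) +ℤ u) +ℤ Σ[ xs ] (λ y → count xs k (b - m * y - x) +ℤ count xs (suc k) (b - m * y))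
      ≡⟨ cong₂ (λ i j → (i +ℤ u) +ℤ j) (count-cong xs k (-‿suc-* b m x)) (Σ-distrib-+ xs _ _) ⟩
    (w +ℤ u) +ℤ (Σ[ xs ] (λ y → count xs k (b - m * y - x)) +ℤ Σ[ xs ] (λ y → count xs (suc k) (b - m * y)))
      ≡⟨ cong (λ i → (w +ℤ u) +ℤ (i +ℤ Σ[ xs ] (λ y → count xs (suc k) (b - m * y))))
              (Σ-cong xs (λ y → count-cong xs k (-‿swap b (m * y) x))) ⟩
    (w +ℤ u) +ℤ (Σ[ xs ] (λ y → count xs k (b - x - m * y)) +ℤ Σ[ xs ] (λ y → count xs (suc k) (b - m * y)))
      ≡⟨ cong₂ (λ i j → (w +ℤ u) +ℤ (i +ℤ j)) (Σ-count m xs k (b - x)) (Σ-count m xs (suc k) b) ⟩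
    (w +ℤ u) +ℤ ((i₁ +ℤ j₁) +ℤ (i₂ +ℤ j₂))
      ≡⟨ arith u w i₁ i₂ j₁ j₂ ⟩
    (u +ℤ (i₁ +ℤ i₂)) +ℤ (w +ℤ (j₁ +ℤ j₂)) ∎
    where
    -- In `u` and `w` the head is the distinguished position, outside the subfamily in `u` and
    -- inside it in `w`. In the other terms a later position is distinguished: the head is chosen in
    -- `i₁` and `j₁`, left out in `i₂` and `j₂`.
    u  = count xs (suc k) (b - m * x)
    w  = count xs k (b - (1# + m) * x)
    i₁ = marked m xs (suc k) (b - x)
    i₂ = marked m xs (suc (suc k)) b
    j₁ = marked (1# + m) xs k (b - x)
    j₂ = marked (1# + m) xs (suc k) b
    arith : ∀ u w i₁ i₂ j₁ j₂ → (w +ℤ u) +ℤ ((i₁ +ℤ j₁) +ℤ (i₂ +ℤ j₂)) ≡ (u +ℤ (i₁ +ℤ i₂)) +ℤ (w +ℤ (j₁ +ℤ j₂))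
    arith = ℤ-Solver.solve-∀

  -- For m = 1 the position x joined to T is a k-element subfamily with sum b, and each such
  -- subfamily arises once from each of its k members.
  marked-one : ∀ xs k b → marked 1# xs k b ≡ + k *ℤ count xs k b
  marked-one xs       zero    b = refl
  marked-one []       (suc k) b = sym (ℤₚ.*-zeroʳ (+ suc k))
  marked-one (x ∷ xs) (suc k) b = begin
    count xs k (b - 1# * x) +ℤ (marked 1# xs k (b - x) +ℤ marked 1# xs (suc k) b)
      ≡⟨ cong₂ _+ℤ_ (count-cong xs k (K.+-congˡ (K.-‿cong (K.*-identityˡ x))))
                    (cong₂ _+ℤ_ (marked-one xs k (b - x)) (marked-one xs (suc k) b)) ⟩
    count xs k (b - x) +ℤ (+ k *ℤ count xs k (b - x) +ℤ (1ℤ +ℤ + k) *ℤ count xs (suc k) b)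
      ≡⟨ arith (+ k) (count xs k (b - x)) (count xs (suc k) b) ⟩
    (1ℤ +ℤ + k) *ℤ (count xs k (b - x) +ℤ count xs (suc k) b) ∎
    where
    arith : ∀ k i j → i +ℤ (k *ℤ i +ℤ (1ℤ +ℤ k) *ℤ j) ≡ (1ℤ +ℤ k) *ℤ (i +ℤ j)
    arith = ℤ-Solver.solve-∀

  -- For m = 0 the position x is free among those outside T. Formally this is `Σ-count` at m = 0,
  -- whose left-hand side has equal terms, with `marked-one` subtracted.
  marked-zero : ∀ xs k b → marked 0# xs (suc k) b ≡ (+ length xs -ℤ + k) *ℤ count xs k b
  marked-zero xs k b = begin
    marked 0# xs (suc k) b
      ≡⟨ arith (marked 0# xs (suc k) b) (marked (1# + 0#) xs k b) ⟩
    (marked 0# xs (suc k) b +ℤ marked (1# + 0#) xs k b) -ℤ marked (1# + 0#) xs k b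
      ≡⟨ cong₂ _-ℤ_ (Σ-count 0# xs k b) (marked-cong (K.sym (K.+-identityʳ 1#)) xs k b) ⟨
    Σ[ xs ] (λ x → count xs k (b - 0# * x)) -ℤ marked 1# xs k b
      ≡⟨ cong₂ _-ℤ_ (trans (Σ-cong xs (λ x → count-cong xs k (b-0*x≈b b x))) (Σ-const xs (count xs k b))) (marked-one xs k b) ⟩
    + length xs *ℤ count xs k b -ℤ + k *ℤ count xs k b
      ≡⟨ arith′ (+ length xs) (+ k) (count xs k b) ⟩
    (+ length xs -ℤ + k) *ℤ count xs k b ∎
    where
    arith : ∀ i j → i ≡ (i +ℤ j) -ℤ j
    arith = ℤ-Solver.solve-∀
    arith′ : ∀ n k i → n *ℤ i -ℤ k *ℤ i ≡ (n -ℤ k) *ℤ i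
    arith′ = ℤ-Solver.solve-∀

  -- Sums over the whole field.

  index : Carrier → Fin q
  index x = proj₁ (K.enum-surj x)

  enum-index : ∀ x → enum (index x) ≈ x
  enum-index x = proj₂ (K.enum-surj x)

  elements : List Carrier
  elements = tabulate enum

  Σ-tabulate : ∀ {n} (g : Fin n → Carrier) (f : Carrier → ℤ) → Σ[ tabulate g ] f ≡ sum (λ i → f (g i))
  Σ-tabulate {zero}  g f = refl
  Σ-tabulate {suc n} g f = cong (f (g zero) +ℤ_) (Σ-tabulate (g ∘ suc) f)

  sum-const : ∀ i → sum {q} (λ _ → i) ≡ + q *ℤ i
  sum-const i = begin
    sum {q} (λ _ → i)             ≡⟨ Σ-tabulate enum (λ _ → i) ⟨
    Σ[ elements ] (λ _ → i)       ≡⟨ Σ-const elements i ⟩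
    + length elements *ℤ i        ≡⟨ cong (λ n → + n *ℤ i) (length-tabulate enum) ⟩
    + q *ℤ i                      ∎

  -- Through `index`, maps inverse to each other up to ≈ become a permutation of `Fin q`, as `enum`
  -- is injective; permuting the summands leaves the sum unchanged.
  sum-bijection : (f : Carrier → ℤ) → (∀ {x y} → x ≈ y → f x ≡ f y) →
    (φ ψ : Carrier → Carrier) → (∀ {x y} → x ≈ y → φ x ≈ φ y) → (∀ {x y} → x ≈ y → ψ x ≈ ψ y) →
    (∀ x → φ (ψ x) ≈ x) → (∀ x → ψ (φ x) ≈ x) →
    sum (λ i → f (φ (enum i))) ≡ sum (λ i → f (enum i))
  sum-bijection f f-cong φ ψ φ-cong ψ-cong φψ ψφ = sym (trans
    (sum-permute (f ∘ enum) (permutation (on-index φ) (on-index ψ) (inverse φ-cong φψ) (inverse ψ-cong ψφ)))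
    (sum-cong-≗ (λ i → f-cong (enum-index (φ (enum i))))))
    where
    on-index : (Carrier → Carrier) → Fin q → Fin q
    on-index χ = index ∘ χ ∘ enum
    inverse : ∀ {χ ω} → (∀ {x y} → x ≈ y → χ x ≈ χ y) → (∀ x → χ (ω x) ≈ x) → ∀ i → on-index χ (on-index ω i) ≡ i
    inverse {χ} {ω} χ-cong χω i = K.enum-inj _ _
      (K.trans (enum-index _) (K.trans (χ-cong (enum-index _)) (χω (enum i))))

  x-[x-y]≈y : ∀ x y → x - (x - y) ≈ y
  x-[x-y]≈y x y = R.begin
    x - (x - y)          R.≈⟨ K.+-congˡ (-‿+-comm x (- y)) ⟨
    x + (- x - - y)      R.≈⟨ K.+-assoc x (- x) (- - y) ⟨
    (x - x) - - y        R.≈⟨ K.+-cong (K.-‿inverseʳ x) (-‿involutive y) ⟩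
    0# + y               R.≈⟨ K.+-identityˡ y ⟩
    y                    R.∎
    where module R = ≈-Reasoning

  x+y-y≈x : ∀ x y → (x + y) - y ≈ x
  x+y-y≈x x y = K.trans (K.+-assoc x y (- y)) (K.trans (K.+-congˡ (K.-‿inverseʳ y)) (K.+-identityʳ x))

  x-y+y≈x : ∀ x y → (x - y) + y ≈ x
  x-y+y≈x x y = K.trans (K.+-assoc x (- y) y) (K.trans (K.+-congˡ (K.-‿inverseˡ y)) (K.+-identityʳ x))

  -- For m ≠ 0 the map x ↦ b - m x is a bijection, with inverse y ↦ n (b - y) where m n = 1. Hence
  -- the left-hand side of Newton's identity for the whole field is independent of b.
  sum-affine : (f : Carrier → ℤ) → (∀ {x y} → x ≈ y → f x ≡ f y) → ∀ m → ¬ m ≈ 0# → ∀ b →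
    sum (λ i → f (b - m * enum i)) ≡ sum (λ i → f (enum i))
  sum-affine f f-cong m m≉0 b with K.inverse m m≉0
  ... | n , m*n≈1 = sum-bijection f f-cong (λ x → b - m * x) (λ y → n * (b - y))
    (λ x≈y → K.+-congˡ (K.-‿cong (K.*-congˡ x≈y)))
    (λ x≈y → K.*-congˡ (K.+-congˡ (K.-‿cong x≈y)))
    (λ y → K.trans (K.+-congˡ (K.-‿cong (cancel m*n≈1 (b - y)))) (x-[x-y]≈y b y))
    (λ x → K.trans (K.*-congˡ (x-[x-y]≈y b (m * x))) (cancel (K.trans (K.*-comm n m) m*n≈1) x))
    where
    cancel : ∀ {m n} → m * n ≈ 1# → ∀ x → m * (n * x) ≈ x
    cancel {m} {n} mn≈1 x = K.trans (K.sym (K.*-assoc m n x)) (K.trans (K.*-congʳ mn≈1) (K.*-identityˡ x))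

  sum-δ : ∀ i → sum (λ j → δ (enum j) *ℤ i) ≡ i
  sum-δ i = begin
    sum (λ j → δ (enum j) *ℤ i)   ≡⟨ sum-supported-at _ (index 0#) off-zero ⟩
    δ (enum (index 0#)) *ℤ i      ≡⟨ cong (_*ℤ i) (δ-zero (enum-index 0#)) ⟩
    1ℤ *ℤ i                         ≡⟨ ℤₚ.*-identityˡ i ⟩
    i                               ∎
    where
    off-zero : ∀ j → j ≢ index 0# → δ (enum j) *ℤ i ≡ 0ℤ
    off-zero j j≢ = cong (_*ℤ i) (δ-nonzero (λ e → j≢ (K.enum-inj _ _ (K.trans e (K.sym (enum-index 0#))))))

  -- Every k-element subfamily has exactly one sum, so all of them are counted. In the induction a
  -- chosen head only translates the targets, and Pascal's rule adds the two cases.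
  sum-count : ∀ xs k → sum (λ i → count xs k (enum i)) ≡ + (length xs C k)
  sum-count []       zero    = trans (sum-cong-≗ (λ i → sym (ℤₚ.*-identityʳ (δ (enum i))))) (sum-δ 1ℤ)
  sum-count []       (suc k) = sum-replicate-zero q
  sum-count (x ∷ xs) zero    = sum-count xs zero
  sum-count (x ∷ xs) (suc k) = begin
    sum (λ i → count xs k (enum i - x) +ℤ count xs (suc k) (enum i))
      ≡⟨ ∑-distrib-+ (λ i → count xs k (enum i - x)) (λ i → count xs (suc k) (enum i)) ⟩
    sum (λ i → count xs k (enum i - x)) +ℤ sum (λ i → count xs (suc k) (enum i))
      ≡⟨ cong₂ _+ℤ_ (trans (sum-bijection (count xs k) (count-cong xs k) (_- x) (_+ x)
             K.+-congʳ K.+-congʳ (λ y → x+y-y≈x y x) (λ y → x-y+y≈x y x)) (sum-count xs k))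
           (sum-count xs (suc k)) ⟩
    + (length xs C k +ℕ length xs C suc k)
      ≡⟨ cong +_ (nCk+nC[k+1]≡[n+1]C[k+1] (length xs) k) ⟩
    + (suc (length xs) C suc k) ∎

  count-zero : ∀ xs b → count xs 0 b ≡ δ b
  count-zero []       b = refl
  count-zero (x ∷ xs) b = count-zero xs b

  -- The discrepancy between the sums 0 and b.

  module Discrepancy (p : ℕ) (ch : HasCharacteristic F p) (b : Carrier) (b≉0 : ¬ b ≈ 0#) where
    open HasCharacteristic ch

    -- The header's d k.
    disc : ℕ → ℤ
    disc k = count elements k 0# -ℤ count elements k b

    mdisc : ℕ → ℕ → ℤ
    mdisc j k = marked (natF F j) elements k 0# -ℤ marked (natF F j) elements k b

    -- By `Σ-count` and `sum-affine` the total of the two marked counts is the same for the targets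
    -- 0 and b, so their discrepancies are opposite.
    mdisc-suc : ∀ j k → ¬ natF F j ≈ 0# → mdisc (suc j) k ≡ -1ℤ *ℤ mdisc j (suc k)
    mdisc-suc j k j≉0 = trans (arith (M j (suc k) 0#) (M (suc j) k 0#) (M j (suc k) b) (M (suc j) k b))
      (trans (cong (-1ℤ *ℤ mdisc j (suc k) +ℤ_) difference≡0) (ℤₚ.+-identityʳ _))
      where
      M : ℕ → ℕ → Carrier → ℤ
      M j = marked (natF F j) elements
      arith : ∀ g₀ h₀ g₁ h₁ → h₀ -ℤ h₁ ≡ -1ℤ *ℤ (g₀ -ℤ g₁) +ℤ ((g₀ +ℤ h₀) -ℤ (g₁ +ℤ h₁))
      arith = ℤ-Solver.solve-∀
      total : ∀ a → M j (suc k) a +ℤ M (suc j) k a ≡ sum (λ i → count elements k (enum i))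
      total a = begin
        M j (suc k) a +ℤ M (suc j) k a
          ≡⟨ Σ-count (natF F j) elements k a ⟨
        Σ[ elements ] (λ x → count elements k (a - natF F j * x))
          ≡⟨ Σ-tabulate enum _ ⟩
        sum (λ i → count elements k (a - natF F j * enum i))
          ≡⟨ sum-affine (count elements k) (count-cong elements k) (natF F j) j≉0 a ⟩
        sum (λ i → count elements k (enum i)) ∎
      difference≡0 : (M j (suc k) 0# +ℤ M (suc j) k 0#) -ℤ (M j (suc k) b +ℤ M (suc j) k b) ≡ 0ℤ
      difference≡0 = trans (cong₂ _-ℤ_ (total 0#) (total b)) (ℤₚ.+-inverseʳ (sum (λ i → count elements k (enum i))))

    -- Going from coefficient 1 to j + 1 applies `mdisc-suc` at the coefficients 1 to j. These are
    -- nonzero because j < p, so the last coefficient reached may be p itself.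
    mdisc-iterate : ∀ j k → j < p → mdisc (suc j) k ≡ -1ℤ ^ j *ℤ mdisc 1 (j +ℕ k)
    mdisc-iterate zero    k j<p = sym (ℤₚ.*-identityˡ _)
    mdisc-iterate (suc j) k j<p = begin
      mdisc (suc (suc j)) k                            ≡⟨ mdisc-suc (suc j) k (minimal (suc j) z<s j<p) ⟩
      -1ℤ *ℤ mdisc (suc j) (suc k)                     ≡⟨ cong (-1ℤ *ℤ_) (mdisc-iterate j (suc k) (ℕₚ.<-trans (ℕₚ.n<1+n j) j<p)) ⟩
      -1ℤ *ℤ (-1ℤ ^ j *ℤ mdisc 1 (j +ℕ suc k))         ≡⟨ ℤₚ.*-assoc -1ℤ (-1ℤ ^ j) _ ⟨
      -1ℤ ^ suc j *ℤ mdisc 1 (j +ℕ suc k)              ≡⟨ cong (λ n → -1ℤ ^ suc j *ℤ mdisc 1 n) (ℕₚ.+-suc j k) ⟩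
      -1ℤ ^ suc j *ℤ mdisc 1 (suc j +ℕ k)              ∎

    mdisc-one : ∀ k → mdisc 1 k ≡ + k *ℤ disc k
    mdisc-one k = trans (cong₂ _-ℤ_ (as-count 0#) (as-count b)) (arith (+ k) (count elements k 0#) (count elements k b))
      where
      as-count : ∀ a → marked (natF F 1) elements k a ≡ + k *ℤ count elements k a
      as-count a = trans (marked-cong (K.+-identityʳ 1#) elements k a) (marked-one elements k a)
      arith : ∀ k x y → k *ℤ x -ℤ k *ℤ y ≡ k *ℤ (x -ℤ y)
      arith = ℤ-Solver.solve-∀

    mdisc-p : ∀ k → mdisc p (suc k) ≡ (+ q -ℤ + k) *ℤ disc k
    mdisc-p k = trans (cong₂ _-ℤ_ (as-count 0#) (as-count b)) (arith (+ q -ℤ + k) (count elements k 0#) (count elements k b))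
      where
      as-count : ∀ a → marked (natF F p) elements (suc k) a ≡ (+ q -ℤ + k) *ℤ count elements k a
      as-count a = begin
        marked (natF F p) elements (suc k) a                ≡⟨ marked-cong p·1≈0 elements (suc k) a ⟩
        marked 0# elements (suc k) a                        ≡⟨ marked-zero elements k a ⟩
        (+ length elements -ℤ + k) *ℤ count elements k a    ≡⟨ cong (λ n → (+ n -ℤ + k) *ℤ count elements k a) (length-tabulate enum) ⟩
        (+ q -ℤ + k) *ℤ count elements k a                  ∎
      arith : ∀ k x y → k *ℤ x -ℤ k *ℤ y ≡ k *ℤ (x -ℤ y)
      arith = ℤ-Solver.solve-∀

    disc-0 : disc 0 ≡ 1ℤ
    disc-0 = trans (cong₂ _-ℤ_ (count-zero elements 0#) (count-zero elements b))
                   (cong₂ _-ℤ_ (δ-zero K.refl) (δ-nonzero b≉0))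

    -- Carrying k times the discrepancy from coefficient 1 to coefficient k + 1 brings the size
    -- index down to 0, where `marked` is 0 by definition.
    disc-initial : ∀ k → 0 < k → k < p → disc k ≡ 0ℤ
    disc-initial k 0<k k<p = ℤₚ.*-cancelˡ-≡ (+ k) _ _ {{>-nonZero 0<k}} (begin
      + k *ℤ disc k                              ≡⟨ mdisc-one k ⟨
      mdisc 1 k                                  ≡⟨ -1^n*-1^n*i≡i k (mdisc 1 k) ⟨
      -1ℤ ^ k *ℤ (-1ℤ ^ k *ℤ mdisc 1 k)          ≡⟨ cong (λ n → -1ℤ ^ k *ℤ (-1ℤ ^ k *ℤ mdisc 1 n)) (ℕₚ.+-identityʳ k) ⟨
      -1ℤ ^ k *ℤ (-1ℤ ^ k *ℤ mdisc 1 (k +ℕ 0))   ≡⟨ cong (-1ℤ ^ k *ℤ_) (mdisc-iterate k 0 k<p) ⟨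
      -1ℤ ^ k *ℤ 0ℤ                              ≡⟨ ℤₚ.*-zeroʳ (-1ℤ ^ k) ⟩
      0ℤ                                         ≡⟨ ℤₚ.*-zeroʳ (+ k) ⟨
      + k *ℤ 0ℤ                                  ∎)

    -- In p - 1 steps the coefficient goes from 1 to p and the size index from k + p to k + 1; the
    -- two ends are evaluated by `mdisc-one` and `mdisc-p`.
    disc-step : ∀ k → + (k +ℕ p) *ℤ disc (k +ℕ p) ≡ -1ℤ ^ suc p *ℤ ((+ q -ℤ + k) *ℤ disc k)
    disc-step k = begin
      + (k +ℕ p) *ℤ disc (k +ℕ p)                      ≡⟨ mdisc-one (k +ℕ p) ⟨
      mdisc 1 (k +ℕ p)                                 ≡⟨ iterate p refl ⟩
      -1ℤ ^ suc p *ℤ mdisc p (suc k)                   ≡⟨ cong (-1ℤ ^ suc p *ℤ_) (mdisc-p k) ⟩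
      -1ℤ ^ suc p *ℤ ((+ q -ℤ + k) *ℤ disc k)          ∎
      where
      arith : ∀ x i → x *ℤ i ≡ (-1ℤ *ℤ (-1ℤ *ℤ x)) *ℤ i
      arith = ℤ-Solver.solve-∀
      -- The fixed p is replaced by a variable that can be matched as a successor. The sign
      -- (-1)^(p-1) is then written as (-1)^(p+1).
      iterate : ∀ n .{{_ : NonZero n}} → n ≡ p → mdisc 1 (k +ℕ n) ≡ -1ℤ ^ suc n *ℤ mdisc n (suc k)
      iterate (suc n) 1+n≡p = begin
        mdisc 1 (k +ℕ suc n)                           ≡⟨ cong (mdisc 1) (trans (ℕₚ.+-suc k n) (trans (cong suc (ℕₚ.+-comm k n)) (sym (ℕₚ.+-suc n k)))) ⟩
        mdisc 1 (n +ℕ suc k)                           ≡⟨ -1^n*-1^n*i≡i n _ ⟨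
        -1ℤ ^ n *ℤ (-1ℤ ^ n *ℤ mdisc 1 (n +ℕ suc k))   ≡⟨ cong (-1ℤ ^ n *ℤ_) (mdisc-iterate n (suc k) (subst (n <_) 1+n≡p (ℕₚ.n<1+n n))) ⟨
        -1ℤ ^ n *ℤ mdisc (suc n) (suc k)               ≡⟨ arith (-1ℤ ^ n) _ ⟩
        -1ℤ ^ suc (suc n) *ℤ mdisc (suc n) (suc k)     ∎

    open Recurrence disc (-1ℤ ^ suc p) p q disc-0 disc-initial disc-step public

  -- From discrepancies to counts, and divisibility of q by p.

  v≡ : ∀ b → v F b ≡ + q *ℤ δ b -ℤ 1ℤ
  v≡ b with does (b ≟ 0#)
  ... | true  = lemma q {{q-nonZero F}}
    where
    lemma : ∀ n .{{_ : NonZero n}} → + (n ∸ℕ 1) ≡ + n *ℤ 1ℤ -ℤ 1ℤ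
    lemma (suc n) = cong (_-ℤ 1ℤ) (sym (ℤₚ.*-identityʳ (+ suc n)))
  ... | false = cong (_-ℤ 1ℤ) (sym (ℤₚ.*-zeroʳ (+ q)))

  -- The count equals z at every nonzero target and z + d at 0. Summing over all targets gives
  -- C(q,k) = q z + d, which eliminates z.
  q*count : ∀ k d → (∀ b → ¬ b ≈ 0# → count elements k 0# -ℤ count elements k b ≡ d) →
    ∀ b → + q *ℤ count elements k b ≡ + (q C k) +ℤ v F b *ℤ d
  q*count k d disc≡d b = begin
    + q *ℤ count elements k b             ≡⟨ cong (+ q *ℤ_) (affine b) ⟩
    + q *ℤ (z +ℤ δ b *ℤ d)                ≡⟨ arith (+ q) z (δ b) d ⟩
    (+ q *ℤ z +ℤ d) +ℤ (+ q *ℤ δ b -ℤ 1ℤ) *ℤ d  ≡⟨ cong₂ (λ i j → i +ℤ j *ℤ d) total (v≡ b) ⟨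
    + (q C k) +ℤ v F b *ℤ d                 ∎
    where
    z = count elements k 0# -ℤ d
    arith : ∀ q z e d → q *ℤ (z +ℤ e *ℤ d) ≡ (q *ℤ z +ℤ d) +ℤ (q *ℤ e -ℤ 1ℤ) *ℤ d
    arith = ℤ-Solver.solve-∀
    at-zero : ∀ x d → x ≡ (x -ℤ d) +ℤ 1ℤ *ℤ d
    at-zero = ℤ-Solver.solve-∀
    off-zero : ∀ x y e → y ≡ (x -ℤ (x -ℤ y)) +ℤ 0ℤ *ℤ e
    off-zero = ℤ-Solver.solve-∀
    affine : ∀ a → count elements k a ≡ z +ℤ δ a *ℤ d
    affine a with a ≟ 0#
    ... | yes a≈0 = trans (count-cong elements k a≈0) (at-zero _ d)
    ... | no  a≉0 = trans (off-zero (count elements k 0#) (count elements k a) d)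
      (cong (λ e → (count elements k 0# -ℤ e) +ℤ 0ℤ *ℤ d) (disc≡d a a≉0))
    total : + (q C k) ≡ + q *ℤ z +ℤ d
    total = begin
      + (q C k)                                              ≡⟨ cong (λ n → + (n C k)) (length-tabulate enum) ⟨
      + (length elements C k)                                ≡⟨ sum-count elements k ⟨
      sum (λ i → count elements k (enum i))                ≡⟨ sum-cong-≗ (λ i → affine (enum i)) ⟩
      sum (λ i → z +ℤ δ (enum i) *ℤ d)                     ≡⟨ ∑-distrib-+ (λ _ → z) (λ i → δ (enum i) *ℤ d) ⟩
      sum {q} (λ _ → z) +ℤ sum (λ i → δ (enum i) *ℤ d)     ≡⟨ cong₂ _+ℤ_ (sum-const z) (sum-δ d) ⟩
      + q *ℤ z +ℤ d                                          ∎

  q≢1 : q ≢ 1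
  q≢1 q≡1 = K.1≉0 (K.trans (K.sym (enum-index 1#))
    (K.trans (K.reflexive (cong enum (Fin1-unique q≡1 (index 1#) (index 0#)))) (enum-index 0#)))

  module _ (p : ℕ) (ch : HasCharacteristic F p) where
    private instance
      p≢0 : NonZero p
      p≢0 = HasCharacteristic.p-nonZero ch

    -- Here d = 0. The case k = q yields `p∣q`, so this comes before the formula that involves q/p.
    q*count-∤ : ∀ k → p ∤ k → ∀ b → + q *ℤ count elements k b ≡ + (q C k)
    q*count-∤ k p∤k b = trans (q*count k 0ℤ (λ a a≉0 → Discrepancy.vanishes-∤ p ch a a≉0 k p∤k) b)
      (trans (cong (+ (q C k) +ℤ_) (ℤₚ.*-zeroʳ (v F b))) (ℤₚ.+-identityʳ _))

    -- Otherwise the only q-element subset would be equidistributed over the q possible sums.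
    p∣q : p ∣ q
    p∣q = decidable-stable (p ∣? q) λ p∤q → q≢1 (ℕₚ.m*n≡1⇒m≡1 q ∣ count elements q 0# ∣
      (trans (sym (ℤₚ.abs-* (+ q) (count elements q 0#)))
             (cong ∣_∣ (trans (q*count-∤ q p∤q 0#) (cong +_ (nCn≡1 q))))))

    q*count-∣ : ∀ k → p ∣ k → ∀ b → + q *ℤ count elements k b ≡ + (q C k) +ℤ v F b *ℤ signedBinomial (q /ℕ p) p k
    q*count-∣ .(m *ℕ p) (divides m refl) = q*count (m *ℕ p) _ (λ a a≉0 → trans
      (Discrepancy.at-multiples p ch a a≉0 (q /ℕ p) (sym (m/n*n≡m p∣q)) m)
      (sym (signedBinomial-multiple (q /ℕ p) p m)))

  -- Restriction to a subset, and removal of zero.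

  selected : ∀ {n} → (Fin n → Carrier) → Subset n → List Carrier
  selected f Vec.[]             = []
  selected f (inside  Vec.∷ D)  = f zero ∷ selected (f ∘ suc) D
  selected f (outside Vec.∷ D)  = selected (f ∘ suc) D

  selected-⊤ : ∀ {n} (f : Fin n → Carrier) → selected f ⊤ ≡ tabulate f
  selected-⊤ {zero}  f = refl
  selected-⊤ {suc n} f = cong (f zero ∷_) (selected-⊤ (f ∘ suc))

  -- At `enum` this unfolds to `selected enum (Fq* F)`; a general f lets inductions pass to
  -- `f ∘ suc`.
  nonzeros : ∀ {n} → (Fin n → Carrier) → List Carrier
  nonzeros f = selected f (Vec.tabulate (λ i → not (does (f i ≟ 0#))))

  nonzeros-all : ∀ {n} (f : Fin n → Carrier) → (∀ i → ¬ f i ≈ 0#) → nonzeros f ≡ tabulate f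
  nonzeros-all {zero}  f f≉0 = refl
  nonzeros-all {suc n} f f≉0 rewrite dec-false (f zero ≟ 0#) (f≉0 zero) =
    cong (f zero ∷_) (nonzeros-all (f ∘ suc) (f≉0 ∘ suc))

  -- A subfamily either omits the only zero entry or contains it, and removing that entry lowers the
  -- size by one without changing the sum.
  count-nonzeros : ∀ {n} (f : Fin n → Carrier) → (∀ i j → f i ≈ f j → i ≡ j) → ∀ i → f i ≈ 0# → ∀ k b →
    count (tabulate f) (suc k) b ≡ count (nonzeros f) (suc k) b +ℤ count (nonzeros f) k b
  count-nonzeros {suc n} f f-inj i fi≈0 k b with f zero ≟ 0#
  -- By injectivity no later entry is zero, so the tail is the whole list of nonzero entries.
  ... | yes f0≈0 rewrite nonzeros-all (f ∘ suc) (λ j fj≈0 → Finₚ.0≢1+n (f-inj zero (suc j) (K.trans f0≈0 (K.sym fj≈0)))) =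
    trans (cong (_+ℤ count (tabulate (f ∘ suc)) (suc k) b) (count-cong (tabulate (f ∘ suc)) k b-f0≈b))
          (ℤₚ.+-comm (count (tabulate (f ∘ suc)) k b) _)
    where
    b-f0≈b : b - f zero ≈ b
    b-f0≈b = K.trans (K.+-congˡ (K.trans (K.-‿cong f0≈0) -0#≈0#)) (K.+-identityʳ b)
  ... | no f0≉0 = shift i fi≈0 k
    where
    arith : ∀ x y z w → (x +ℤ y) +ℤ (z +ℤ w) ≡ (x +ℤ z) +ℤ (y +ℤ w)
    arith = ℤ-Solver.solve-∀
    ys = nonzeros (f ∘ suc)
    shift : ∀ i → f i ≈ 0# → ∀ k → count (f zero ∷ tabulate (f ∘ suc)) (suc k) b
      ≡ count (f zero ∷ ys) (suc k) b +ℤ count (f zero ∷ ys) k b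
    shift zero    f0≈0 k = contradiction f0≈0 f0≉0
    -- For k = 0 a chosen head leaves the empty subfamily, to which the induction does not apply;
    -- both sides are then `δ (b - f zero)`.
    shift (suc i) fi≈0 zero = trans
      (cong₂ _+ℤ_ (trans (count-zero (tabulate (f ∘ suc)) (b - f zero)) (sym (count-zero ys (b - f zero)))) (rec 0 b))
      (sym (ℤₚ.+-assoc (count ys 0 (b - f zero)) (count ys 1 b) (count ys 0 b)))
      where rec = count-nonzeros (f ∘ suc) (λ j k e → Finₚ.suc-injective (f-inj (suc j) (suc k) e)) i fi≈0
    shift (suc i) fi≈0 (suc k) = trans
      (cong₂ _+ℤ_ (rec k (b - f zero)) (rec (suc k) b))
      (arith (count ys (suc k) (b - f zero)) (count ys k (b - f zero)) (count ys (suc (suc k)) b) (count ys (suc k) b))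
      where rec = count-nonzeros (f ∘ suc) (λ j k e → Finₚ.suc-injective (f-inj (suc j) (suc k) e)) i fi≈0

  -- The number N as a value of `count`.

  -- The filter predicate of `N`, for any family f so that its first entry can be split off.
  selects : ∀ {n} → (Fin n → Carrier) → Subset n → ℕ → Carrier → Subset n → Bool
  selects f D k b S = does (S ⊆? D) ∧ (Subset.∣ S ∣ ≡ᵇ k) ∧ does (sumOver F f S ≟ b)

  -- Both sides obey the same recursion on D: an index outside D is never chosen, an index of D is
  -- chosen or skipped, and a chosen entry moves to the target by subtraction.
  numberOf-selects : ∀ {n} (f : Fin n → Carrier) D k b → + numberOf (selects f D k b) ≡ count (selected f D) k b
  numberOf-selects f Vec.[] zero b
    -- `selects` compares the empty sum with b, whereas `δ` compares b with 0.
    rewrite does-⇔ (mk⇔ K.sym K.sym) (0# ≟ b) (b ≟ 0#) with does (b ≟ 0#)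
  ... | true  = refl
  ... | false = refl
  numberOf-selects f Vec.[] (suc k) b = refl
  numberOf-selects {suc n} f (outside Vec.∷ D) k b = begin
    + numberOf (selects f (outside Vec.∷ D) k b)                   ≡⟨ cong +_ (numberOf-suc (selects f (outside Vec.∷ D) k b)) ⟩
    + (numberOf {n} (λ _ → false) +ℕ numberOf (selects (f ∘ suc) D k b))  ≡⟨ cong (λ m → + (m +ℕ numberOf (selects (f ∘ suc) D k b))) (length-filterᵇ-false (subsets n)) ⟩
    + numberOf (selects (f ∘ suc) D k b)                           ≡⟨ numberOf-selects (f ∘ suc) D k b ⟩
    count (selected (f ∘ suc) D) k b                               ∎
  numberOf-selects {suc n} f (inside Vec.∷ D) zero b = begin
    + numberOf (selects f (inside Vec.∷ D) 0 b)
      ≡⟨ cong +_ (numberOf-suc (selects f (inside Vec.∷ D) 0 b)) ⟩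
    + (numberOf {n} (λ S → does (S ⊆? D) ∧ false) +ℕ numberOf (selects (f ∘ suc) D 0 b))
      ≡⟨ cong (λ m → + (m +ℕ numberOf (selects (f ∘ suc) D 0 b)))
           (trans (length-filterᵇ-cong (λ S → ∧-zeroʳ (does (S ⊆? D))) (subsets n)) (length-filterᵇ-false (subsets n))) ⟩
    + numberOf (selects (f ∘ suc) D 0 b)
      ≡⟨ numberOf-selects (f ∘ suc) D 0 b ⟩
    count (selected (f ∘ suc) D) 0 b ∎
  numberOf-selects {suc n} f (inside Vec.∷ D) (suc k) b = begin
    + numberOf (selects f (inside Vec.∷ D) (suc k) b)
      ≡⟨ cong +_ (numberOf-suc (selects f (inside Vec.∷ D) (suc k) b)) ⟩
    + (numberOf (λ S → selects f (inside Vec.∷ D) (suc k) b (inside Vec.∷ S)) +ℕ numberOf (selects (f ∘ suc) D (suc k) b))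
      ≡⟨ cong (λ m → + (m +ℕ numberOf (selects (f ∘ suc) D (suc k) b))) (length-filterᵇ-cong
           (λ S → cong (λ e → does (S ⊆? D) ∧ (Subset.∣ S ∣ ≡ᵇ k) ∧ e) (move (sumOver F (f ∘ suc) S))) (subsets n)) ⟩
    + (numberOf (selects (f ∘ suc) D k (b - f zero)) +ℕ numberOf (selects (f ∘ suc) D (suc k) b))
      ≡⟨ cong₂ _+ℤ_ (numberOf-selects (f ∘ suc) D k (b - f zero)) (numberOf-selects (f ∘ suc) D (suc k) b) ⟩
    count (selected (f ∘ suc) D) k (b - f zero) +ℤ count (selected (f ∘ suc) D) (suc k) b ∎
    where
    move : ∀ s → does ((f zero + s) ≟ b) ≡ does (s ≟ (b - f zero))
    move s = does-⇔ (mk⇔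
      (λ e → K.trans (K.sym (x+y-y≈x s (f zero))) (K.+-congʳ (K.trans (K.+-comm s (f zero)) e)))
      (λ e → K.trans (K.+-comm (f zero) s) (K.trans (K.+-congʳ e) (x-y+y≈x b (f zero)))))
      ((f zero + s) ≟ b) (s ≟ (b - f zero))

  -- The subset enumeration inside N is local to its definition and cannot be named, so it is
  -- recovered by unification: `with` replaces q by a variable, which determines the underscore.
  mutual
    localSubsets : ℕ → Carrier → Subset q → ∀ n → List (Subset n)
    localSubsets k b D n = _

    N≡numberOf : ∀ k b D → N F k b D ≡ numberOf (selects enum D k b)
    N≡numberOf k b D with q | filterᵇ (selects enum D k b)
    ... | n | f = cong (λ xs → length (f xs)) (localSubsets≡subsets k b D n)

    localSubsets≡subsets : ∀ k b D n → localSubsets k b D n ≡ subsets n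
    localSubsets≡subsets k b D zero    = refl
    localSubsets≡subsets k b D (suc n) =
      cong (λ xs → map (inside Vec.∷_) xs ++ map (outside Vec.∷_) xs) (localSubsets≡subsets k b D n)

  N≡count : ∀ k b D → + N F k b D ≡ count (selected enum D) k b
  N≡count k b D = trans (cong +_ (N≡numberOf k b D)) (numberOf-selects enum D k b)

  -- The nonzero elements, and division by q.

  module _ (p : ℕ) (ch : HasCharacteristic F p) where
    private instance
      p≢0 : NonZero p
      p≢0 = HasCharacteristic.p-nonZero ch
      q≢0 : NonZero q
      q≢0 = q-nonZero F

    private
      r-1 : ℕ
      r-1 = q /ℕ p ∸ℕ 1

      1+[q-1]≡q : suc (q ∸ℕ 1) ≡ q
      1+[q-1]≡q = ℕₚ.suc-pred q

      1+r-1≡q/p : suc r-1 ≡ q /ℕ p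
      -- As p divides q, the quotient q/p is at least 1 and the truncated subtraction in `r-1` is
      -- exact.
      1+r-1≡q/p = ℕₚ.suc-pred (q /ℕ p) {{>-nonZero (m≥n⇒m/n>0 (∣⇒≤ (p∣q p ch)))}}

    -- By `count-nonzeros` the count at k + 1 is that for the whole field minus the one at k, and
    -- Pascal's rule gives the right-hand side the same recursion. The induction starts from 1 +
    -- v(b) = q δ(b) at k = 0.
    q*count-nonzeros : ∀ k b → + q *ℤ count (nonzeros enum) k b ≡ + ((q ∸ℕ 1) C k) +ℤ v F b *ℤ signedBinomial r-1 p k
    q*count-nonzeros zero b = begin
      + q *ℤ count (nonzeros enum) 0 b             ≡⟨ cong (+ q *ℤ_) (count-zero (nonzeros enum) b) ⟩
      + q *ℤ δ b                                   ≡⟨ arith (+ q) (δ b) ⟩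
      1ℤ +ℤ (+ q *ℤ δ b -ℤ 1ℤ) *ℤ 1ℤ               ≡⟨ cong₂ (λ i j → 1ℤ +ℤ i *ℤ j) (v≡ b) (signedBinomial-multiple r-1 p 0) ⟨
      1ℤ +ℤ v F b *ℤ signedBinomial r-1 p 0        ∎
      where
      arith : ∀ q e → q *ℤ e ≡ 1ℤ +ℤ (q *ℤ e -ℤ 1ℤ) *ℤ 1ℤ
      arith = ℤ-Solver.solve-∀
    q*count-nonzeros (suc k) b = begin
      + q *ℤ count (nonzeros enum) (suc k) b
        ≡⟨ arith (+ q) (count (nonzeros enum) (suc k) b) (count (nonzeros enum) k b) ⟩
      + q *ℤ (count (nonzeros enum) (suc k) b +ℤ count (nonzeros enum) k b) -ℤ + q *ℤ count (nonzeros enum) k b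
        ≡⟨ cong₂ (λ i j → + q *ℤ i -ℤ j) (sym (count-nonzeros enum K.enum-inj (index 0#) (enum-index 0#) k b)) (q*count-nonzeros k b) ⟩
      + q *ℤ count elements (suc k) b -ℤ (x +ℤ v F b *ℤ s)
        ≡⟨ cong (_-ℤ (x +ℤ v F b *ℤ s)) all-elements ⟩
      ((x +ℤ y) +ℤ v F b *ℤ (t +ℤ s)) -ℤ (x +ℤ v F b *ℤ s)
        ≡⟨ arith′ x y (v F b) s t ⟩
      y +ℤ v F b *ℤ t ∎
      where
      x = + ((q ∸ℕ 1) C k)
      y = + ((q ∸ℕ 1) C suc k)
      s = signedBinomial r-1 p k
      t = signedBinomial r-1 p (suc k)
      arith : ∀ q i j → q *ℤ i ≡ q *ℤ (i +ℤ j) -ℤ q *ℤ j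
      arith = ℤ-Solver.solve-∀
      arith′ : ∀ x y w s t → ((x +ℤ y) +ℤ w *ℤ (t +ℤ s)) -ℤ (x +ℤ w *ℤ s) ≡ y +ℤ w *ℤ t
      arith′ = ℤ-Solver.solve-∀
      qC[1+k] : + (q C suc k) ≡ x +ℤ y
      qC[1+k] = cong +_ (trans (cong (_C suc k) (sym 1+[q-1]≡q)) (sym (nCk+nC[k+1]≡[n+1]C[k+1] (q ∸ℕ 1) k)))
      -- One formula serves both cases: the two signed binomials add up to the one for q/p if p
      -- divides k + 1, and to 0 otherwise.
      all-elements : + q *ℤ count elements (suc k) b ≡ (x +ℤ y) +ℤ v F b *ℤ (t +ℤ s)
      all-elements with p ∣? suc k
      ... | yes p∣1+k = trans (q*count-∣ p ch (suc k) p∣1+k b) (cong₂ (λ i j → i +ℤ v F b *ℤ j) qC[1+k]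
              (sym (trans (signedBinomial-pascal-∣ r-1 p k p∣1+k) (cong (λ n → signedBinomial n p (suc k)) 1+r-1≡q/p))))
      ... | no p∤1+k = begin
        + q *ℤ count elements (suc k) b     ≡⟨ q*count-∤ p ch (suc k) p∤1+k b ⟩
        + (q C suc k)                       ≡⟨ qC[1+k] ⟩
        x +ℤ y                              ≡⟨ ℤₚ.+-identityʳ (x +ℤ y) ⟨
        (x +ℤ y) +ℤ 0ℤ                      ≡⟨ cong ((x +ℤ y) +ℤ_) (ℤₚ.*-zeroʳ (v F b)) ⟨
        (x +ℤ y) +ℤ v F b *ℤ 0ℤ             ≡⟨ cong (λ i → (x +ℤ y) +ℤ v F b *ℤ i) (signedBinomial-pascal-∤ r-1 p k p∤1+k) ⟨
        (x +ℤ y) +ℤ v F b *ℤ (t +ℤ s)       ∎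

    N-Fq : ∀ k b → + N F k b (Fq F) ≡ count elements k b
    N-Fq k b = trans (N≡count k b ⊤) (cong (λ xs → count xs k b) (selected-⊤ enum))

    as-fractions : ∀ a i w n k → + q *ℤ a ≡ i +ℤ w *ℤ signedBinomial n p k →
      a / 1 ≡ i / q +ℚ (-1ℤ ^ (k +ℕ k /ℕ p) *ℤ w *ℤ + (n C (k /ℕ p))) / q
    as-fractions a i w n k eq = trans
      (n*a≡i⇒a≡i/n q a _ (trans eq (cong (i +ℤ_) (arith w (-1ℤ ^ (k +ℕ k /ℕ p)) (+ (n C (k /ℕ p)))))))
      (+-distribʳ-/ q i _)
      where
      arith : ∀ w σ j → w *ℤ (σ *ℤ j) ≡ σ *ℤ w *ℤ j
      arith = ℤ-Solver.solve-∀

theorem1p2 : ∀ {c ℓ} (F : FiniteField c ℓ) (p : ℕ) (ch : HasCharacteristic F p)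
    (b : FiniteField.Carrier F) →
    let q = FiniteField.q F
        instance _ = q-nonZero F
        instance _ = HasCharacteristic.p-nonZero ch
    in ((k : ℕ) → 1 ≤ k → k ≤ q ∸ℕ 1 →
          (+ N F k b (Fq* F)) / 1
            ≡ ((+ ((q ∸ℕ 1) C k)) / q)
              +ℚ (((-1ℤ ^ (k +ℕ (k /ℕ p))) *ℤ v F b *ℤ (+ (((q /ℕ p) ∸ℕ 1) C (k /ℕ p)))) / q))
       × ((k : ℕ) → 1 ≤ k → k ≤ q → p ∤ k →
          (+ N F k b (Fq F)) / 1 ≡ (+ (q C k)) / q)
       × ((k : ℕ) → 1 ≤ k → k ≤ q → p ∣ k →
          (+ N F k b (Fq F)) / 1
            ≡ ((+ (q C k)) / q)
              +ℚ (((-1ℤ ^ (k +ℕ (k /ℕ p))) *ℤ v F b *ℤ (+ ((q /ℕ p) C (k /ℕ p)))) / q))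
theorem1p2 F p ch b =
    (λ k _ _ → as-fractions F p ch (+ N F k b (Fq* F)) (+ ((q ∸ℕ 1) C k)) (v F b) (q /ℕ p ∸ℕ 1) k
      (trans (cong (+ q *ℤ_) (N≡count F k b (Fq* F))) (q*count-nonzeros F p ch k b)))
  , (λ k _ _ p∤k → n*a≡i⇒a≡i/n q (+ N F k b (Fq F)) (+ (q C k))
      (trans (cong (+ q *ℤ_) (N-Fq F p ch k b)) (q*count-∤ F p ch k p∤k b)))
  , (λ k _ _ p∣k → as-fractions F p ch (+ N F k b (Fq F)) (+ (q C k)) (v F b) (q /ℕ p) k
      (trans (cong (+ q *ℤ_) (N-Fq F p ch k b)) (q*count-∣ F p ch k p∣k b)))
  where
  open FiniteField F using (q)
  instance
    _ = q-nonZero F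
    _ = HasCharacteristic.p-nonZero ch
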